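{- Let $A\in\mathcal{V}$ and let $g:B(Con(A))\rightarrow Clop(Max(A))$ be the map $g(\alpha)=Max(A)\cap D_A(\alpha)$. Then $Rad(A)$ has $CBLP$ if and only if $g$ is a Boolean isomorphism.
   Context: $\mathcal{V}$ is a congruence modular, semidegenerate variety (no nontrivial algebra has a one-element subalgebra) of finite signature. For $B\in\mathcal{V}$: $Con(B)$ is its congruence lattice with bounds $\Delta_B,\nabla_B$, $[\cdot,\cdot]$ the Freese–McKenzie commutator, $K(B)$ the compact congruences. A congruence $\phi\neq\nabla_B$ is prime if $[\alpha,\beta]\subseteq\phi$ implies $\alpha\subseteq\phi$ or $\beta\subseteq\phi$; $Spec(B)$ is the set of primes, $Max(B)$ the set of maximal congruences, $Rad(B)=\bigcap Max(B)$; $\rho(\theta)$ is the intersection of primes containing $\theta$. $D_B(\theta)=\{\phi\in Spec(B):\theta\not\subseteq\phi\}$; these are the open sets of the topology on $Spec(B)$, and $Max(B)$ has the subspace topology; $Clop(X)$ is the Boolean algebra of clopen subsets of $X$. $B(Con(B))$ is the Boolean algebra of complemented elements of $Con(B)$ (for $\alpha\in B(Con(A))$, $Max(A)\cap D_A(\alpha)$ is clopen in $Max(A)$ and $g$ is a Boolean morphism). When $K(B)$ is closed under the commutator, the reticulation $L(B)=K(B)/{\equiv}$ ($\alpha\equiv\beta$ iff $\rho(\alpha)=\rho(\beta)$) is a bounded distributive lattice with canonical map $\lambda_B$, mapping $B(Con(B))$ injectively into $B(L(B))$; the reticulation preserves the Boolean center if this map is onto $B(L(B))$. Standing assumption: for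 every $B\in\mathcal{V}$, $K(B)$ is closed under the commutator and the reticulation of $B$ preserves the Boolean center. A congruence $\theta$ of $A$ has $CBLP$ if for every $\beta\in B(Con(A/\theta))$ there is $\alpha\in B(Con(A))$ with $(\alpha\vee\theta)/\theta=\beta$. -}

module Defs where

open import Level using (Level; _⊔_; Lift; lift; lower) renaming (suc to lsuc)
open import Axiom.ExcludedMiddle using (ExcludedMiddle)
open import Algebra.Lattice.Bundles using (BooleanAlgebra)
open import Algebra.Lattice.Morphism.Structures using (IsLatticeIsomorphism)
open import Algebra.Lattice.Structures.Biased using (isBooleanAlgebraʳ)
open import Data.Bool.Base using (Bool; true; false)
open import Data.Empty using (⊥; ⊥-elim)
open import Data.Fin.Base using (Fin; zero; suc; _↑ˡ_; _↑ʳ_)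
open import Data.List.Base using (List; []; _∷_; _++_; concat; tabulate)
open import Data.List.Membership.Propositional using (_∈_)
open import Data.List.Membership.Propositional.Properties using (∈-++⁺ˡ; ∈-++⁺ʳ; ∈-concat⁺′; ∈-tabulate⁺)
open import Data.List.Relation.Unary.Any using (here; there)
open import Data.Nat.Base as ℕ using (ℕ)
open import Data.Product.Base using (∃₂; Σ-syntax; ∃-syntax; _×_; _,_; proj₁; proj₂; map₂; swap)
open import Data.Sum.Base using (_⊎_; inj₁; inj₂; [_,_])
open import Data.Unit.Polymorphic.Base using (⊤; tt)
import Data.Vec.Functional as VF
import Data.Vec.Functional.Properties as VFₚ
open import Function.Base using (_∘_; const; id)
open import Relation.Binary.Core using (Rel; _⇒_)
open import Relation.Binary.Bundles using (Poset)
open import Relation.Binary.Structures using (IsEquivalence)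
open import Relation.Binary.Lattice.Bundles using (BoundedLattice; DistributiveLattice)
import Relation.Binary.Lattice.Properties.Lattice as LatticeProps
import Relation.Binary.Lattice.Properties.DistributiveLattice as DistributiveLatticeProps
open import Relation.Binary.PropositionalEquality.Core using (_≡_; refl)
open import Relation.Nullary using (¬_; yes; no)
open import Relation.Nullary.Decidable using (True; toWitness; fromWitness; map′)
open import Relation.Unary as U using (Pred; _≐_; _⊢_)

-- Zorn's lemma for posets (c, ℓ₁, ℓ₂) and chains given by predicates of
-- level p. Nonemptiness of the poset comes from the empty chain.
Zorn : ∀ c ℓ₁ ℓ₂ p → Set (lsuc (c ⊔ ℓ₁ ⊔ ℓ₂ ⊔ p))
Zorn c ℓ₁ ℓ₂ p = (P : Poset c ℓ₁ ℓ₂) → let open Poset P in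
  (∀ (C : Pred Carrier p) → (∀ x y → C x → C y → (x ≤ y) ⊎ (y ≤ x)) →
     ∃[ u ] (∀ x → C x → x ≤ u)) →
  ∃[ m ] (∀ x → m ≤ x → x ≈ m)

module _ {c ℓ₁ ℓ₂} (L : BoundedLattice c ℓ₁ ℓ₂) where
  open BoundedLattice L renaming (⊤ to 𝟏; ⊥ to 𝟎)

  IsComplement : Rel Carrier ℓ₁
  IsComplement x y = ((x ∨ y) ≈ 𝟏) × ((x ∧ y) ≈ 𝟎)

  Complemented : Pred Carrier (c ⊔ ℓ₁)
  Complemented x = ∃[ y ] IsComplement x y

  Modular : Set (c ⊔ ℓ₁ ⊔ ℓ₂)
  Modular = ∀ x y z → x ≤ z → (x ∨ (y ∧ z)) ≈ ((x ∨ y) ∧ z)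

module _ {c ℓ₁ ℓ₂} (L : BoundedLattice c ℓ₁ ℓ₂) where
  private module L = BoundedLattice L
  open L using (Carrier; _≈_; _≤_; _∨_; _∧_)

  toBooleanAlgebra : (∀ x y z → (x ∧ (y ∨ z)) ≤ ((x ∧ y) ∨ (x ∧ z))) →
                     (neg : Carrier → Carrier) →
                     (∀ x → L.⊤ ≤ (x ∨ neg x)) → (∀ x → (x ∧ neg x) ≤ L.⊥) →
                     BooleanAlgebra c ℓ₁
  toBooleanAlgebra distrib neg x∨¬x x∧¬x = record
    { _∨_ = _∨_ ; _∧_ = _∧_ ; ¬_ = neg ; ⊤ = L.⊤ ; ⊥ = L.⊥
    ; isBooleanAlgebra = isBooleanAlgebraʳ record
      { isDistributiveLattice = record
        { isLattice   = LatticeProps.isAlgLattice L.lattice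
        ; ∨-distrib-∧ = DistributiveLatticeProps.∨-distrib-∧ DL
        ; ∧-distrib-∨ = DistributiveLatticeProps.∧-distrib-∨ DL
        }
      ; ∨-complementʳ = λ x → L.antisym (L.maximum _) (x∨¬x x)
      ; ∧-complementʳ = λ x → L.antisym (x∧¬x x) (L.minimum _)
      ; ¬-cong        = λ {x} {y} x≈y → L.antisym
          (neg-antitone y x (L.reflexive (L.Eq.sym x≈y)))
          (neg-antitone x y (L.reflexive x≈y))
      }
    }
    where
    DL : DistributiveLattice c ℓ₁ ℓ₂
    DL = record { isDistributiveLattice = record
      { isLattice    = L.isLattice
      ; ∧-distribˡ-∨ = λ x y z → L.antisym (distrib x y z)
          (L.∨-least (L.∧-greatest (L.x∧y≤x _ _) (L.trans (L.x∧y≤y _ _) (L.x≤x∨y _ _)))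
                     (L.∧-greatest (L.x∧y≤x _ _) (L.trans (L.x∧y≤y _ _) (L.y≤x∨y _ _))))
      } }

    neg-antitone : ∀ x y → x ≤ y → neg y ≤ neg x
    neg-antitone x y x≤y =
      L.trans (L.∧-greatest L.refl (L.trans (L.maximum _) (x∨¬x x)))
      (L.trans (distrib _ _ _)
      (L.∨-least
        (L.trans (L.∧-greatest (L.trans (L.x∧y≤y _ _) x≤y) (L.x∧y≤x _ _))
                 (L.trans (x∧¬x y) (L.minimum _)))
        (L.x∧y≤y _ _)))

record IsBooleanIsomorphism {b₁ ℓ₁ b₂ ℓ₂}
         (B₁ : BooleanAlgebra b₁ ℓ₁) (B₂ : BooleanAlgebra b₂ ℓ₂)
         (f : BooleanAlgebra.Carrier B₁ → BooleanAlgebra.Carrier B₂)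
         : Set (b₁ ⊔ ℓ₁ ⊔ b₂ ⊔ ℓ₂) where
  private
    module B₁ = BooleanAlgebra B₁
    module B₂ = BooleanAlgebra B₂
  field
    isLatticeIsomorphism : IsLatticeIsomorphism B₁.rawLattice B₂.rawLattice f
    ⊤-homo               : f B₁.⊤ B₂.≈ B₂.⊤
    ⊥-homo               : f B₁.⊥ B₂.≈ B₂.⊥
    ¬-homo               : ∀ x → f (B₁.¬ x) B₂.≈ (B₂.¬ f x)

record Signature : Set where
  field
    size  : ℕ
    arity : Fin size → ℕ

  Op : Set
  Op = Fin size

open Signature

data Term (𝑆 : Signature) {x} (X : Set x) : Set x where
  var : X → Term 𝑆 X
  op  : (f : Op 𝑆) → (Fin (arity 𝑆 f) → Term 𝑆 X) → Term 𝑆 X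

_⟪_⟫ : ∀ {𝑆 x y} {X : Set x} {Y : Set y} → Term 𝑆 X → (X → Term 𝑆 Y) → Term 𝑆 Y
var x   ⟪ σ ⟫ = σ x
op f ts ⟪ σ ⟫ = op f (λ i → ts i ⟪ σ ⟫)

-- Elements are compared by _≈_, so that quotients are available. As usual
-- in universal algebra, carriers are nonempty.
record Algebra (𝑆 : Signature) (ℓ : Level) : Set (lsuc ℓ) where
  infix 4 _≈_
  field
    Carrier       : Set ℓ
    _≈_           : Rel Carrier ℓ
    isEquivalence : IsEquivalence _≈_
    ⟦_⟧           : (f : Op 𝑆) → (Fin (arity 𝑆 f) → Carrier) → Carrier
    ⟦⟧-cong       : ∀ f {xs ys} → (∀ i → xs i ≈ ys i) → ⟦ f ⟧ xs ≈ ⟦ f ⟧ ys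
    nonempty      : Carrier

  module ≈ = IsEquivalence isEquivalence

  eval : ∀ {x} {X : Set x} → Term 𝑆 X → (X → Carrier) → Carrier
  eval (var x)   ρ = ρ x
  eval (op f ts) ρ = ⟦ f ⟧ (λ i → eval (ts i) ρ)

  IsSubuniverse : ∀ {p} → Pred Carrier p → Set (ℓ ⊔ p)
  IsSubuniverse P = ∀ f xs → (∀ i → P (xs i)) → P (⟦ f ⟧ xs)

  HasOneElementSubalgebra : Set ℓ
  HasOneElementSubalgebra = ∃[ e ] IsSubuniverse (_≈ e)

  Nontrivial : Set ℓ
  Nontrivial = ∃₂ λ x y → ¬ (x ≈ y)

  eval-cong : ∀ {x} {X : Set x} (t : Term 𝑆 X) {ρ σ : X → Carrier} →
              (∀ x → ρ x ≈ σ x) → eval t ρ ≈ eval t σ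
  eval-cong (var x)   eq = eq x
  eval-cong (op f ts) eq = ⟦⟧-cong f (λ i → eval-cong (ts i) eq)

  eval-⟪⟫ : ∀ {x y} {X : Set x} {Y : Set y} (t : Term 𝑆 X) (σ : X → Term 𝑆 Y) ρ →
            eval (t ⟪ σ ⟫) ρ ≈ eval t (λ x → eval (σ x) ρ)
  eval-⟪⟫ (var x)   σ ρ = ≈.refl
  eval-⟪⟫ (op f ts) σ ρ = ⟦⟧-cong f (λ i → eval-⟪⟫ (ts i) σ ρ)

record Congruence {𝑆 ℓ} (A : Algebra 𝑆 ℓ) : Set (lsuc ℓ) where
  open Algebra A using (Carrier; _≈_; ⟦_⟧)
  field
    rel           : Rel Carrier ℓ
    isEquivalence : IsEquivalence rel
    reflexive     : _≈_ ⇒ rel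
    compatible    : ∀ f {xs ys} → (∀ i → rel (xs i) (ys i)) → rel (⟦ f ⟧ xs) (⟦ f ⟧ ys)

  open IsEquivalence isEquivalence public using (refl; sym; trans)

open Congruence using (rel)

module _ {𝑆 ℓ} (A : Algebra 𝑆 ℓ) where
  open Algebra A using (Carrier; _≈_; ⟦_⟧; module ≈)

  data CgRel (R : Rel Carrier ℓ) : Rel Carrier ℓ where
    base  : ∀ {x y} → R x y → CgRel R x y
    equal : ∀ {x y} → x ≈ y → CgRel R x y
    sym   : ∀ {x y} → CgRel R x y → CgRel R y x
    trans : ∀ {x y z} → CgRel R x y → CgRel R y z → CgRel R x z
    comp  : ∀ f {xs ys} → (∀ i → CgRel R (xs i) (ys i)) → CgRel R (⟦ f ⟧ xs) (⟦ f ⟧ ys)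

  Cg : Rel Carrier ℓ → Congruence A
  Cg R = record
    { rel           = CgRel R
    ; isEquivalence = record { refl = equal ≈.refl ; sym = sym ; trans = trans }
    ; reflexive     = equal
    ; compatible    = comp
    }

  _/_ : Congruence A → Algebra 𝑆 ℓ
  _/_ θ = record
    { Carrier       = Carrier
    ; _≈_           = rel θ
    ; isEquivalence = Congruence.isEquivalence θ
    ; ⟦_⟧           = ⟦_⟧
    ; ⟦⟧-cong       = Congruence.compatible θ
    ; nonempty      = Algebra.nonempty A
    }

module _ {𝑆 ℓ} {A : Algebra 𝑆 ℓ} where
  open Algebra A using (Carrier; _≈_; ⟦_⟧; module ≈)

  infix 4 _⊆_ _≋_
  infixr 6 _∨_
  infixr 7 _∧_

  _⊆_ : Rel (Congruence A) ℓ
  α ⊆ β = ∀ {x y} → rel α x y → rel β x y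

  _≋_ : Rel (Congruence A) ℓ
  α ≋ β = (α ⊆ β) × (β ⊆ α)

  ∇ : Congruence A
  ∇ = record { rel = λ _ _ → ⊤ ; isEquivalence = _ ; reflexive = _ ; compatible = _ }

  Δ : Congruence A
  Δ = record { rel = _≈_ ; isEquivalence = Algebra.isEquivalence A
             ; reflexive = id ; compatible = Algebra.⟦⟧-cong A }

  _∧_ : Congruence A → Congruence A → Congruence A
  α ∧ β = record
    { rel           = λ x y → rel α x y × rel β x y
    ; isEquivalence = record
      { refl  = α.refl , β.refl
      ; sym   = λ (p , q) → α.sym p , β.sym q
      ; trans = λ (p , q) (p′ , q′) → α.trans p p′ , β.trans q q′
      }
    ; reflexive     = λ p → α.reflexive p , β.reflexive p
    ; compatible    = λ f ps → α.compatible f (proj₁ ∘ ps) , β.compatible f (proj₂ ∘ ps)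
    }
    where
    module α = Congruence α
    module β = Congruence β

  ⋁ : {I : Set ℓ} → (I → Congruence A) → Congruence A
  ⋁ θ = Cg A (λ x y → ∃[ i ] rel (θ i) x y)

  _∨_ : Congruence A → Congruence A → Congruence A
  α ∨ β = Cg A (λ x y → rel α x y ⊎ rel β x y)

  Cg-least : (R : Rel Carrier ℓ) (θ : Congruence A) → R ⇒ rel θ → Cg A R ⊆ θ
  Cg-least R θ R⇒θ = go
    where
    module θ = Congruence θ
    go : Cg A R ⊆ θ
    go (base p)    = R⇒θ p
    go (equal p)   = θ.reflexive p
    go (sym p)     = θ.sym (go p)
    go (trans p q) = θ.trans (go p) (go q)
    go (comp f ps) = θ.compatible f (λ i → go (ps i))

  ∨-least : ∀ α β γ → α ⊆ γ → β ⊆ γ → α ∨ β ⊆ γ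
  ∨-least α β γ p q = Cg-least _ γ [ p , q ]

  rel-eval : ∀ (θ : Congruence A) {x} {X : Set x} (t : Term 𝑆 X) {ρ σ : X → Carrier} →
             (∀ x → rel θ (ρ x) (σ x)) → rel θ (Algebra.eval A t ρ) (Algebra.eval A t σ)
  rel-eval θ (var x)   eq = eq x
  rel-eval θ (op f ts) eq = Congruence.compatible θ f (λ i → rel-eval θ (ts i) eq)

  -- A congruence χ containing θ induces the congruence χ/θ on A / θ.
  _/ᶜ_∋_ : (χ θ : Congruence A) → θ ⊆ χ → Congruence (A / θ)
  χ /ᶜ θ ∋ θ⊆χ = record
    { rel = rel χ ; isEquivalence = χ.isEquivalence ; reflexive = θ⊆χ ; compatible = χ.compatible }
    where module χ = Congruence χ

  -- I ranges over Set ℓ only; under excluded middle this is no restriction, as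
  -- congruences are determined by maps Carrier → Carrier → Bool.
  Compact : Pred (Congruence A) (lsuc ℓ)
  Compact α = {I : Set ℓ} (θ : I → Congruence A) → α ⊆ ⋁ θ →
              Σ[ is ∈ List I ] (α ⊆ ⋁ {∃[ i ] (i ∈ is)} (θ ∘ proj₁))

  IsMaximal : Pred (Congruence A) (lsuc ℓ)
  IsMaximal φ = ¬ (∇ ⊆ φ) × (∀ ψ → φ ⊆ ψ → ¬ (∇ ⊆ ψ) → ψ ⊆ φ)

  -- The term condition C(α, β; δ).
  Centralizes : (α β δ : Congruence A) → Set ℓ
  Centralizes α β δ =
    ∀ {m n} (t : Term 𝑆 (Fin m ⊎ Fin n)) (a a′ : Fin m → Carrier) (b b′ : Fin n → Carrier) →
    (∀ i → rel α (a i) (a′ i)) → (∀ j → rel β (b j) (b′ j)) →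
    rel δ (Algebra.eval A t [ a , b ]) (Algebra.eval A t [ a , b′ ]) →
    rel δ (Algebra.eval A t [ a′ , b ]) (Algebra.eval A t [ a′ , b′ ])

Con : ∀ {𝑆 ℓ} → Algebra 𝑆 ℓ → BoundedLattice (lsuc ℓ) ℓ ℓ
Con A = record
  { Carrier = Congruence A
  ; _≈_ = _≋_ ; _≤_ = _⊆_ ; _∨_ = _∨_ ; _∧_ = _∧_ ; ⊤ = ∇ ; ⊥ = Δ
  ; isBoundedLattice = record
    { isLattice = record
      { isPartialOrder = record
        { isPreorder = record
          { isEquivalence = record
            { refl  = id , id
            ; sym   = swap
            ; trans = λ (p , q) (p′ , q′) → (λ z → p′ (p z)) , (λ z → q (q′ z))
            }
          ; reflexive = proj₁
          ; trans     = λ p q z → q (p z)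
          }
        ; antisym = _,_
        }
      ; supremum = λ α β → (λ p → base (inj₁ p)) , (λ p → base (inj₂ p)) , ∨-least α β
      ; infimum  = λ α β → proj₁ , proj₂ , λ γ p q z → p z , q z
      }
    ; maximum = _
    ; minimum = λ α → Congruence.reflexive α
    }
  }

-- A variety is the class of models of a set of identities.
record Variety (𝑆 : Signature) (ℓ : Level) : Set (lsuc ℓ) where
  field
    Identity : Rel (Term 𝑆 ℕ) ℓ

infix 4 _∈ᵥ_

_∈ᵥ_ : ∀ {𝑆 ℓ} → Algebra 𝑆 ℓ → Variety 𝑆 ℓ → Set ℓ
A ∈ᵥ V = ∀ s t → Variety.Identity V s t → ∀ ρ → eval s ρ ≈ eval t ρ
  where open Algebra A

CongruenceModular : ∀ {𝑆 ℓ} → Variety 𝑆 ℓ → Set (lsuc ℓ)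
CongruenceModular V = ∀ B → B ∈ᵥ V → Modular (Con B)

Semidegenerate : ∀ {𝑆 ℓ} → Variety 𝑆 ℓ → Set (lsuc ℓ)
Semidegenerate V = ∀ B → B ∈ᵥ V → Algebra.Nontrivial B → ¬ Algebra.HasOneElementSubalgebra B

module _ {𝑆 ℓ} (A B : Algebra 𝑆 ℓ) where
  private
    module A = Algebra A
    module B = Algebra B

  hom-eval : (h : A.Carrier → B.Carrier) →
             (∀ f xs → h (A.⟦ f ⟧ xs) B.≈ B.⟦ f ⟧ (h ∘ xs)) →
             ∀ {x} {X : Set x} (t : Term 𝑆 X) ρ → h (A.eval t ρ) B.≈ B.eval t (h ∘ ρ)
  hom-eval h hom (var x)   ρ = B.≈.refl
  hom-eval h hom (op f ts) ρ =
    B.≈.trans (hom f _) (B.⟦⟧-cong f (λ i → hom-eval h hom (ts i) ρ))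

module _ {𝑆 ℓ} (V : Variety 𝑆 ℓ) (A : Algebra 𝑆 ℓ) (A∈V : A ∈ᵥ V) (θ : Congruence A) where
  private module θ = Congruence θ

  /-∈ᵥ : (A / θ) ∈ᵥ V
  /-∈ᵥ s t st ρ = θ.trans (θ.sym (hom s)) (θ.trans (θ.reflexive (A∈V s t st ρ)) (hom t))
    where
    hom : ∀ t → rel θ (Algebra.eval A t ρ) (Algebra.eval (A / θ) t ρ)
    hom t = hom-eval A (A / θ) id (λ _ _ → θ.refl) t ρ

-- A congruence viewed as a subalgebra of A × A.
module Graph {𝑆 ℓ} (A : Algebra 𝑆 ℓ) (γ : Congruence A) where
  private
    module A = Algebra A
    module γ = Congruence γ

  𝔾 : Algebra 𝑆 ℓ
  𝔾 = record
    { Carrier       = Σ[ (x , y) ∈ A.Carrier × A.Carrier ] rel γ x y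
    ; _≈_           = λ ((x , y) , _) ((x′ , y′) , _) → (x A.≈ x′) × (y A.≈ y′)
    ; isEquivalence = record
      { refl  = A.≈.refl , A.≈.refl
      ; sym   = λ (p , q) → A.≈.sym p , A.≈.sym q
      ; trans = λ (p , q) (p′ , q′) → A.≈.trans p p′ , A.≈.trans q q′
      }
    ; ⟦_⟧           = λ f us → (A.⟦ f ⟧ (proj₁ ∘ proj₁ ∘ us) , A.⟦ f ⟧ (proj₂ ∘ proj₁ ∘ us))
                             , γ.compatible f (proj₂ ∘ us)
    ; ⟦⟧-cong       = λ f ps → A.⟦⟧-cong f (proj₁ ∘ ps) , A.⟦⟧-cong f (proj₂ ∘ ps)
    ; nonempty      = (A.nonempty , A.nonempty) , γ.refl
    }
  module 𝔾 = Algebra 𝔾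

  π₁ π₂ : 𝔾.Carrier → A.Carrier
  π₁ = proj₁ ∘ proj₁
  π₂ = proj₂ ∘ proj₁

  diag : A.Carrier → 𝔾.Carrier
  diag x = (x , x) , γ.refl

  𝔾-∈ᵥ : (V : Variety 𝑆 ℓ) → A ∈ᵥ V → 𝔾 ∈ᵥ V
  𝔾-∈ᵥ V A∈V s t st ρ = via π₁ (λ _ _ → A.≈.refl) , via π₂ (λ _ _ → A.≈.refl)
    where
    via : (π : 𝔾.Carrier → A.Carrier) → (∀ f xs → π (𝔾.⟦ f ⟧ xs) A.≈ A.⟦ f ⟧ (π ∘ xs)) →
          π (𝔾.eval s ρ) A.≈ π (𝔾.eval t ρ)
    via π hom = A.≈.trans (hom-eval 𝔾 A π hom s ρ)
               (A.≈.trans (A∈V s t st _) (A.≈.sym (hom-eval 𝔾 A π hom t ρ)))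

  data Diag (R : Rel A.Carrier ℓ) : Rel 𝔾.Carrier ℓ where
    diagonal : ∀ {x y} → R x y → Diag R (diag x) (diag y)

  -- The matrix entries of the term condition as elements of the graph.
  module _ {m n} (t : Term 𝑆 (Fin m ⊎ Fin n)) (a : Fin m → A.Carrier)
           (b b′ : Fin n → A.Carrier) (b~b′ : ∀ j → rel γ (b j) (b′ j)) where

    row : 𝔾.Carrier
    row = 𝔾.eval t [ diag ∘ a , (λ j → (b j , b′ j) , b~b′ j) ]

    π₁-row : π₁ row A.≈ A.eval t [ a , b ]
    π₁-row = A.≈.trans (hom-eval 𝔾 A π₁ (λ _ _ → A.≈.refl) t _)
      (A.eval-cong t λ { (inj₁ _) → A.≈.refl ; (inj₂ _) → A.≈.refl })

    π₂-row : π₂ row A.≈ A.eval t [ a , b′ ]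
    π₂-row = A.≈.trans (hom-eval 𝔾 A π₂ (λ _ _ → A.≈.refl) t _)
      (A.eval-cong t λ { (inj₁ _) → A.≈.refl ; (inj₂ _) → A.≈.refl })

    row-rel : (δ : Congruence A) → rel δ (A.eval t [ a , b ]) (A.eval t [ a , b′ ]) →
              rel δ (π₁ row) (π₂ row)
    row-rel δ p = δ.trans (δ.reflexive π₁-row) (δ.trans p (δ.reflexive (A.≈.sym π₂-row)))
      where module δ = Congruence δ

    rel-row : (δ : Congruence A) → rel δ (π₁ row) (π₂ row) →
              rel δ (A.eval t [ a , b ]) (A.eval t [ a , b′ ])
    rel-row δ p = δ.trans (δ.reflexive (A.≈.sym π₁-row)) (δ.trans p (δ.reflexive π₂-row))
      where module δ = Congruence δ

-- A set P is a union of classes of Cg R as soon as each polynomial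
-- translate of a pair in R has both or neither of its components in P.
module Invariance {𝑆 ℓ} (B : Algebra 𝑆 ℓ) (P : Pred (Algebra.Carrier B) ℓ)
                  (P-resp : ∀ {x y} → Algebra._≈_ B x y → P x → P y) where
  open Algebra B

  Same : Rel Carrier ℓ
  Same x y = ∀ {n} (f : Term 𝑆 (Fin 1 ⊎ Fin n)) (c : Fin n → Carrier) →
    (P (eval f [ const x , c ]) → P (eval f [ const y , c ])) ×
    (P (eval f [ const y , c ]) → P (eval f [ const x , c ]))

  private
    same-sym : ∀ {x y} → Same x y → Same y x
    same-sym s f c = swap (s f c)

    many : ∀ k {n} (p : Term 𝑆 (Fin k ⊎ Fin n)) (xs ys : Fin k → Carrier) (c : Fin n → Carrier) →
           (∀ i → Same (xs i) (ys i)) → P (eval p [ xs , c ]) → P (eval p [ ys , c ])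
    many ℕ.zero    p xs ys c same = P-resp (eval-cong p λ { (inj₂ _) → ≈.refl })
    many (ℕ.suc k) {n} p xs ys c same h =
      P-resp (≈.trans (eval-⟪⟫ p σ₂ _) (eval-cong p eq₂))
        (many k (p ⟪ σ₂ ⟫) (xs ∘ suc) (ys ∘ suc) (ys zero VF.∷ c) (same ∘ suc)
          (P-resp (≈.sym (≈.trans (eval-⟪⟫ p σ₂ _) (eval-cong p eq₂′)))
            (P-resp (≈.trans (eval-⟪⟫ p σ₁ _) (eval-cong p (eq₁ (ys zero))))
              (proj₁ (same zero (p ⟪ σ₁ ⟫) c₁)
                (P-resp (≈.sym (≈.trans (eval-⟪⟫ p σ₁ _) (eval-cong p eq₁′))) h)))))
      where
      c₁ : Fin (k ℕ.+ n) → Carrier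
      c₁ = (xs ∘ suc) VF.++ c
      σ₁ : Fin (ℕ.suc k) ⊎ Fin n → Term 𝑆 (Fin 1 ⊎ Fin (k ℕ.+ n))
      σ₁ (inj₁ zero)    = var (inj₁ zero)
      σ₁ (inj₁ (suc i)) = var (inj₂ (i ↑ˡ n))
      σ₁ (inj₂ j)       = var (inj₂ (k ↑ʳ j))
      σ₂ : Fin (ℕ.suc k) ⊎ Fin n → Term 𝑆 (Fin k ⊎ Fin (ℕ.suc n))
      σ₂ (inj₁ zero)    = var (inj₂ zero)
      σ₂ (inj₁ (suc i)) = var (inj₁ i)
      σ₂ (inj₂ j)       = var (inj₂ (suc j))
      eq₁ : ∀ z v → eval (σ₁ v) [ const z , c₁ ] ≈ [ z VF.∷ (xs ∘ suc) , c ] v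
      eq₁ z (inj₁ zero)    = ≈.refl
      eq₁ z (inj₁ (suc i)) = ≈.reflexive (VFₚ.lookup-++ˡ (xs ∘ suc) c i)
      eq₁ z (inj₂ j)       = ≈.reflexive (VFₚ.lookup-++ʳ (xs ∘ suc) c j)
      eq₁′ : ∀ v → eval (σ₁ v) [ const (xs zero) , c₁ ] ≈ [ xs , c ] v
      eq₁′ (inj₁ zero)    = ≈.refl
      eq₁′ (inj₁ (suc i)) = eq₁ (xs zero) (inj₁ (suc i))
      eq₁′ (inj₂ j)       = eq₁ (xs zero) (inj₂ j)
      eq₂ : ∀ v → eval (σ₂ v) [ ys ∘ suc , ys zero VF.∷ c ] ≈ [ ys , c ] v
      eq₂ (inj₁ zero)    = ≈.refl
      eq₂ (inj₁ (suc i)) = ≈.refl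
      eq₂ (inj₂ j)       = ≈.refl
      eq₂′ : ∀ v → eval (σ₂ v) [ xs ∘ suc , ys zero VF.∷ c ] ≈ [ ys zero VF.∷ (xs ∘ suc) , c ] v
      eq₂′ (inj₁ zero)    = ≈.refl
      eq₂′ (inj₁ (suc i)) = ≈.refl
      eq₂′ (inj₂ j)       = ≈.refl

    same-comp : ∀ g {xs ys} → (∀ i → Same (xs i) (ys i)) →
                ∀ {n} (f : Term 𝑆 (Fin 1 ⊎ Fin n)) (c : Fin n → Carrier) →
                P (eval f [ const (⟦ g ⟧ xs) , c ]) → P (eval f [ const (⟦ g ⟧ ys) , c ])
    same-comp g {xs} {ys} same {n} f c h =
      P-resp (≈.trans (eval-⟪⟫ f σ _) (eval-cong f (eq ys)))
        (many _ (f ⟪ σ ⟫) xs ys c same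
          (P-resp (≈.sym (≈.trans (eval-⟪⟫ f σ _) (eval-cong f (eq xs)))) h))
      where
      σ : Fin 1 ⊎ Fin n → Term 𝑆 (Fin (arity 𝑆 g) ⊎ Fin n)
      σ (inj₁ _) = op g (var ∘ inj₁)
      σ (inj₂ j) = var (inj₂ j)
      eq : ∀ zs v → eval (σ v) [ zs , c ] ≈ [ const (⟦ g ⟧ zs) , c ] v
      eq zs (inj₁ _) = ≈.refl
      eq zs (inj₂ _) = ≈.refl

    Cg⇒Same : ∀ {R} → R ⇒ Same → CgRel B R ⇒ Same
    Cg⇒Same R⇒S (base p) f c = R⇒S p f c
    Cg⇒Same R⇒S (equal {x} {y} p) {n} f c =
      P-resp (eval-cong f eq) , P-resp (≈.sym (eval-cong f eq))
      where
      eq : (v : Fin 1 ⊎ Fin n) → [ const x , c ] v ≈ [ const y , c ] v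
      eq (inj₁ _) = p
      eq (inj₂ _) = ≈.refl
    Cg⇒Same R⇒S (sym p) f c = swap (Cg⇒Same R⇒S p f c)
    Cg⇒Same R⇒S (trans p q) f c =
      let (u , v) = Cg⇒Same R⇒S p f c ; (u′ , v′) = Cg⇒Same R⇒S q f c
      in u′ ∘ u , v ∘ v′
    Cg⇒Same R⇒S (comp g ps) f c =
      same-comp g (λ i → Cg⇒Same R⇒S (ps i)) f c ,
      same-comp g (λ i → same-sym (Cg⇒Same R⇒S (ps i))) f c

  invariant : ∀ {R} → R ⇒ Same → ∀ {x y} → CgRel B R x y → P x → P y
  invariant R⇒S p = proj₁ (Cg⇒Same R⇒S p (var {X = Fin 1 ⊎ Fin 0} (inj₁ zero)) λ ())

module _ {𝑆 ℓ} (A : Algebra 𝑆 ℓ) where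

  -- Gumm's shifting lemma.
  shifting : Modular (Con A) → ∀ α β γ → α ∧ β ⊆ γ →
             ∀ {x y z u} → rel β x y → rel γ x y → rel α x z → rel α y u → rel β z u → rel γ z u
  shifting mod α β γ α∧β⊆γ βxy γxy αxz αyu βzu =
    ∨-least (β ∧ γ) (α ∧ β) γ proj₂ α∧β⊆γ
      (proj₂ (mod (β ∧ γ) α β proj₁)
        (trans (base (inj₂ (Congruence.sym α αxz)))
          (trans (base (inj₁ (βxy , γxy))) (base (inj₂ αyu))) , βzu))

module _ {𝑆 ℓ} (A : Algebra 𝑆 ℓ) where
  private module A = Algebra A

  -- If each pair in R lies in a congruence centralizing γ modulo δ, then δ ∩ γ
  -- is a union of classes of the congruence on γ generated by the pairs
  -- ((x , x) , (y , y)) with R x y.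
  diag-invariant : (γ δ : Congruence A) (R : Rel A.Carrier ℓ) →
    (∀ {x y} → R x y → ∃[ α ] (rel α x y × Centralizes α γ δ)) →
    ∀ {u v} → CgRel (Graph.𝔾 A γ) (Graph.Diag A γ R) u v →
    rel δ (Graph.π₁ A γ u) (Graph.π₂ A γ u) → rel δ (Graph.π₁ A γ v) (Graph.π₂ A γ v)
  diag-invariant γ δ R hyp = Invariance.invariant 𝔾 P (λ {u} {v} → P-resp {u} {v}) same
    where
    open Graph A γ
    module δ = Congruence δ
    P : Pred 𝔾.Carrier ℓ
    P u = rel δ (π₁ u) (π₂ u)
    P-resp : ∀ {u v} → u 𝔾.≈ v → P u → P v
    P-resp (p , q) h = δ.trans (δ.reflexive (A.≈.sym p)) (δ.trans h (δ.reflexive q))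
    move : ∀ {x y} α → rel α x y → Centralizes α γ δ →
           ∀ {n} (f : Term 𝑆 (Fin 1 ⊎ Fin n)) c →
           P (𝔾.eval f [ const (diag x) , c ]) → P (𝔾.eval f [ const (diag y) , c ])
    move {x} {y} α xy C f c h =
      row-rel f (const y) (π₁ ∘ c) (π₂ ∘ c) (proj₂ ∘ c) δ
        (C f (const x) (const y) (π₁ ∘ c) (π₂ ∘ c) (λ _ → xy) (proj₂ ∘ c)
          (rel-row f (const x) (π₁ ∘ c) (π₂ ∘ c) (proj₂ ∘ c) δ h))
    same : Diag R ⇒ Invariance.Same 𝔾 P (λ {u} {v} → P-resp {u} {v})
    same (diagonal r) f c = let (α , xy , C) = hyp r in
      move α xy C f c , move α (Congruence.sym α xy) C f c

  diag-Cg : (γ α : Congruence A) (R : Rel A.Carrier ℓ) → α ⊆ Cg A R → ∀ {x y} → rel α x y →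
            CgRel (Graph.𝔾 A γ) (Graph.Diag A γ R) (Graph.diag A γ x) (Graph.diag A γ y)
  diag-Cg γ α R α⊆ p = go (α⊆ p)
    where
    open Graph A γ
    go : ∀ {x y} → CgRel A R x y → CgRel 𝔾 (Diag R) (diag x) (diag y)
    go (base r)    = base (diagonal r)
    go (equal p)   = equal (p , p)
    go (sym p)     = sym (go p)
    go (trans p q) = trans (go p) (go q)
    go (comp f ps) = trans (equal (A.≈.refl , A.≈.refl))
                    (trans (comp f (λ i → go (ps i))) (equal (A.≈.refl , A.≈.refl)))

  rows-related : (γ α : Congruence A) (R : Rel A.Carrier ℓ) → α ⊆ Cg A R →
    ∀ {m n} (t : Term 𝑆 (Fin m ⊎ Fin n)) a a′ b b′ → (∀ i → rel α (a i) (a′ i)) →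
    (b~b′ : ∀ j → rel γ (b j) (b′ j)) →
    CgRel (Graph.𝔾 A γ) (Graph.Diag A γ R)
      (Graph.row A γ t a b b′ b~b′) (Graph.row A γ t a′ b b′ b~b′)
  rows-related γ α R α⊆ t a a′ b b′ a~a′ b~b′ =
    rel-eval (Cg 𝔾 (Diag R)) t
      λ { (inj₁ i) → diag-Cg γ α R α⊆ (a~a′ i) ; (inj₂ _) → equal (A.≈.refl , A.≈.refl) }
    where open Graph A γ

  centralizes-∨ : ∀ α β γ δ → Centralizes α γ δ → Centralizes β γ δ → Centralizes (α ∨ β) γ δ
  centralizes-∨ α β γ δ Cα Cβ t a a′ b b′ a~a′ b~b′ h =
    rel-row t a′ b b′ b~b′ δ
      (diag-invariant γ δ _ (λ { (inj₁ p) → α , p , Cα ; (inj₂ p) → β , p , Cβ })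
        (rows-related γ (α ∨ β) _ id t a a′ b b′ a~a′ b~b′)
        (row-rel t a b b′ b~b′ δ h))
    where open Graph A γ

  -- In a congruence modular variety, Centralizes α β is upward closed.
  centralizes-mono : (V : Variety 𝑆 ℓ) → CongruenceModular V → A ∈ᵥ V →
    ∀ α β δ δ′ → Centralizes α β δ → δ ⊆ δ′ → Centralizes α β δ′
  centralizes-mono V cm A∈V α β δ δ′ C δ⊆δ′ t a a′ b b′ a~a′ b~b′ h =
    rel-row t a′ b b′ b~b′ δ′
      (shifting 𝔾 mod Δα η₁ δ₀ Δα∧η₁⊆δ₀ {x = u} {y = diag (π₂ u)} {z = v} {u = diag (π₂ v)}
        A.≈.refl (row-rel t a b b′ b~b′ δ′ h) u~v
        (diag-Cg β α (rel α) base (Δα⊆α₂ u~v))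
        A.≈.refl)
    where
    open Graph A β
    module δ′ = Congruence δ′
    module α = Congruence α
    module β = Congruence β
    mod : Modular (Con 𝔾)
    mod = cm 𝔾 (𝔾-∈ᵥ V A∈V)
    u v : 𝔾.Carrier
    u = row t a b b′ b~b′
    v = row t a′ b b′ b~b′
    Δα : Congruence 𝔾
    Δα = Cg 𝔾 (Diag (rel α))
    pull : (π : 𝔾.Carrier → A.Carrier) → (∀ {u v} → u 𝔾.≈ v → π u A.≈ π v) →
           (∀ f xs → π (𝔾.⟦ f ⟧ xs) ≡ A.⟦ f ⟧ (π ∘ xs)) → Congruence A → Congruence 𝔾
    pull π π-cong π-hom θ = record
      { rel           = λ u v → rel θ (π u) (π v)
      ; isEquivalence = record { refl = θ.refl ; sym = θ.sym ; trans = θ.trans }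
      ; reflexive     = θ.reflexive ∘ π-cong
      ; compatible    = λ f {xs} {ys} ps → compat f xs ys ps
      }
      where
      module θ = Congruence θ
      compat : ∀ f xs ys → (∀ i → rel θ (π (xs i)) (π (ys i))) →
               rel θ (π (𝔾.⟦ f ⟧ xs)) (π (𝔾.⟦ f ⟧ ys))
      compat f xs ys ps rewrite π-hom f xs | π-hom f ys = θ.compatible f ps
    η₀ η₁ δ₀ : Congruence 𝔾
    η₀ = pull π₁ proj₁ (λ _ _ → refl) Δ
    η₁ = pull π₂ proj₂ (λ _ _ → refl) Δ
    δ₀ = pull π₁ proj₁ (λ _ _ → refl) δ′
    u~v : rel Δα u v
    u~v = rows-related β α (rel α) base t a a′ b b′ a~a′ b~b′
    Δα⊆α₂ : ∀ {u v} → rel Δα u v → rel α (π₂ u) (π₂ v)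
    Δα⊆α₂ = Cg-least (Diag (rel α)) (pull π₂ proj₂ (λ _ _ → refl) α) (λ { (diagonal p) → p })
    Δα∧η₁⊆δ₀ : Δα ∧ η₁ ⊆ δ₀
    Δα∧η₁⊆δ₀ {(p , q) , βpq} {(r , s) , βrs} (Δuv , q≈s) = δ′.sym (δ⊆δ′
      (diag-invariant β δ (rel α) (λ p → α , p , C)
        (shifting 𝔾 mod η₀ η₁ Δα (λ (e₀ , e₁) → equal (e₀ , e₁))
          {z = diag p} {u = (r , p) , βrp} q≈s Δuv A.≈.refl A.≈.refl A.≈.refl)
        (Congruence.refl δ)))
      where
      βrp : rel β r p
      βrp = β.trans βrs (β.trans (β.reflexive (A.≈.sym q≈s)) (β.sym βpq))

module _ {𝑆 ℓ} {A : Algebra 𝑆 ℓ} where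
  private module A = Algebra A

  ⋁ᶠ : {I : Set ℓ} → (I → Congruence A) → List I → Congruence A
  ⋁ᶠ {I} θ is = ⋁ {I = ∃[ i ] (i ∈ is)} (θ ∘ proj₁)

  ⋁ᶠ-mono : {I : Set ℓ} (θ : I → Congruence A) {is js : List I} →
            (∀ {i} → i ∈ is → i ∈ js) → ⋁ᶠ θ is ⊆ ⋁ᶠ θ js
  ⋁ᶠ-mono θ {is} {js} is⊆js =
    Cg-least _ (⋁ᶠ θ js) (λ ((i , i∈) , p) → base ((i , is⊆js i∈) , p))

  collect : {I : Set ℓ} (θ : I → Congruence A) {k : ℕ} (xs ys : Fin k → A.Carrier) →
            (∀ j → ∃[ is ] rel (⋁ᶠ θ is) (xs j) (ys j)) →
            ∃[ is ] (∀ j → rel (⋁ᶠ θ is) (xs j) (ys j))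
  collect θ xs ys h = concat (tabulate (proj₁ ∘ h)) , λ j →
    ⋁ᶠ-mono θ (λ i∈ → ∈-concat⁺′ i∈ (∈-tabulate⁺ j)) (proj₂ (h j))

  ⋁-finitary : {I : Set ℓ} (θ : I → Congruence A) → ∀ {x y} →
               rel (⋁ θ) x y → ∃[ is ] rel (⋁ᶠ θ is) x y
  ⋁-finitary θ (base (i , p)) = i ∷ [] , base ((i , here refl) , p)
  ⋁-finitary θ (equal p)      = [] , equal p
  ⋁-finitary θ (sym p)        = map₂ sym (⋁-finitary θ p)
  ⋁-finitary θ (trans p q)    =
    let (is , p′) = ⋁-finitary θ p ; (js , q′) = ⋁-finitary θ q in
    is ++ js , trans (⋁ᶠ-mono θ ∈-++⁺ˡ p′) (⋁ᶠ-mono θ (∈-++⁺ʳ is) q′)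
  ⋁-finitary θ (comp f {xs} {ys} ps) =
    map₂ (comp f) (collect θ xs ys (λ i → ⋁-finitary θ (ps i)))

  finitelyGenerated⇒compact : ∀ {k} (xs ys : Fin k → A.Carrier) (α : Congruence A) →
    (∀ j → rel α (xs j) (ys j)) → (∀ β → (∀ j → rel β (xs j) (ys j)) → α ⊆ β) → Compact α
  finitelyGenerated⇒compact xs ys α gen least θ α⊆ =
    let (is , h) = collect θ xs ys (λ j → ⋁-finitary θ (α⊆ (gen j)))
    in is , least (⋁ᶠ θ is) h

  Δ-compact : Compact (Δ {A = A})
  Δ-compact θ _ = [] , equal

  ∨-compact : ∀ α β → Compact α → Compact β → Compact (α ∨ β)
  ∨-compact α β cα cβ θ α∨β⊆ =
    let (is , p) = cα θ (λ z → α∨β⊆ (base (inj₁ z)))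
        (js , q) = cβ θ (λ z → α∨β⊆ (base (inj₂ z)))
    in is ++ js , ∨-least α β (⋁ᶠ θ (is ++ js))
         (λ z → ⋁ᶠ-mono θ ∈-++⁺ˡ (p z)) (λ z → ⋁ᶠ-mono θ (∈-++⁺ʳ is) (q z))

-- Excluded middle also serves to resize propositions: it makes the
-- intersection of an arbitrary set of congruences a congruence of level ℓ.

module Classical {ℓ} (em : ExcludedMiddle (lsuc ℓ)) where

  ‖_‖ : Set (lsuc ℓ) → Set ℓ
  ‖ P ‖ = Lift ℓ (True (em {P}))

  ‖‖⁺ : ∀ {P} → P → ‖ P ‖
  ‖‖⁺ p = lift (fromWitness p)

  ‖‖⁻ : ∀ {P} → ‖ P ‖ → P
  ‖‖⁻ p = toWitness (lower p)

  em₀ : ExcludedMiddle ℓ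
  em₀ {P} = map′ lower lift (em {Lift (lsuc ℓ) P})

  ¬¬-elim : {P : Set ℓ} → ¬ ¬ P → P
  ¬¬-elim {P} ¬¬p with em₀ {P}
  ... | yes p = p
  ... | no ¬p = ⊥-elim (¬¬p ¬p)

  module _ {𝑆} {A : Algebra 𝑆 ℓ} where

    ⋂ : Pred (Congruence A) (lsuc ℓ) → Congruence A
    ⋂ P = record
      { rel           = λ x y → ‖ (∀ θ → P θ → rel θ x y) ‖
      ; isEquivalence = record
        { refl  = ‖‖⁺ (λ θ _ → Congruence.refl θ)
        ; sym   = λ p → ‖‖⁺ (λ θ h → Congruence.sym θ (‖‖⁻ p θ h))
        ; trans = λ p q → ‖‖⁺ (λ θ h → Congruence.trans θ (‖‖⁻ p θ h) (‖‖⁻ q θ h))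
        }
      ; reflexive     = λ p → ‖‖⁺ (λ θ _ → Congruence.reflexive θ p)
      ; compatible    = λ f ps → ‖‖⁺ (λ θ h → Congruence.compatible θ f (λ i → ‖‖⁻ (ps i) θ h))
      }

    ⋂-lower : ∀ P θ → P θ → ⋂ P ⊆ θ
    ⋂-lower P θ h p = ‖‖⁻ p θ h

    ⋂-greatest : ∀ P α → (∀ θ → P θ → α ⊆ θ) → α ⊆ ⋂ P
    ⋂-greatest P α h p = ‖‖⁺ (λ θ hθ → h θ hθ p)

    -- The Freese–McKenzie commutator: the least δ such that α centralizes β
    -- modulo δ (see commutator-centralizes and commutator-least).
    [_,_]ᶜ : Congruence A → Congruence A → Congruence A
    [ α , β ]ᶜ = ⋂ (λ δ → Lift (lsuc ℓ) (Centralizes α β δ))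

    commutator-centralizes : ∀ α β → Centralizes α β [ α , β ]ᶜ
    commutator-centralizes α β t a a′ b b′ p q h =
      ‖‖⁺ (λ δ C → lower C t a a′ b b′ p q (‖‖⁻ h δ C))

    commutator-least : ∀ α β δ → Centralizes α β δ → [ α , β ]ᶜ ⊆ δ
    commutator-least α β δ C = ⋂-lower _ δ (lift (λ {m} {n} → C {m} {n}))

    commutator⊆ˡ : ∀ α β → [ α , β ]ᶜ ⊆ α
    commutator⊆ˡ α β = commutator-least α β α (λ t a a′ b b′ p q h →
      α.trans (α.sym (move t a a′ b p)) (α.trans h (move t a a′ b′ p)))
      where
      module α = Congruence α
      move : ∀ {m n} (t : Term 𝑆 (Fin m ⊎ Fin n)) a a′ b → (∀ i → rel α (a i) (a′ i)) →
             rel α (Algebra.eval A t [ a , b ]) (Algebra.eval A t [ a′ , b ])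
      move t a a′ b p = rel-eval α t λ { (inj₁ i) → p i ; (inj₂ _) → α.refl }

    commutator⊆ʳ : ∀ α β → [ α , β ]ᶜ ⊆ β
    commutator⊆ʳ α β = commutator-least α β β (λ t a a′ b b′ p q h →
      rel-eval β t λ { (inj₁ _) → Congruence.refl β ; (inj₂ j) → q j })

    IsPrime : Pred (Congruence A) (lsuc ℓ)
    IsPrime φ = ¬ (∇ ⊆ φ) × (∀ α β → [ α , β ]ᶜ ⊆ φ → (α ⊆ φ) ⊎ (β ⊆ φ))

    prime-elim : ∀ {r} {R : Set r} φ → IsPrime φ → ∀ α β → [ α , β ]ᶜ ⊆ φ →
                 (α ⊆ φ → R) → (β ⊆ φ → R) → R
    prime-elim φ φ-prime α β αβ⊆φ l r with proj₂ φ-prime α β αβ⊆φ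
    ... | inj₁ α⊆φ = l α⊆φ
    ... | inj₂ β⊆φ = r β⊆φ

    ρ : Congruence A → Congruence A
    ρ θ = ⋂ (λ φ → IsPrime φ × (θ ⊆ φ))

    ρ-lower : ∀ θ φ → IsPrime φ → θ ⊆ φ → ρ θ ⊆ φ
    ρ-lower θ φ φ-prime θ⊆φ p = ‖‖⁻ p φ (φ-prime , θ⊆φ)

    ρ-greatest : ∀ α θ → (∀ φ → IsPrime φ → θ ⊆ φ → α ⊆ φ) → α ⊆ ρ θ
    ρ-greatest α θ h p = ‖‖⁺ (λ φ (φ-prime , θ⊆φ) → h φ φ-prime θ⊆φ p)

    ρ-mono : ∀ α β → α ⊆ β → ρ α ⊆ ρ β
    ρ-mono α β α⊆β = ρ-greatest (ρ α) β (λ φ φ-prime β⊆φ →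
      ρ-lower α φ φ-prime (λ z → β⊆φ (α⊆β z)))

    ⊆ρ : ∀ α → α ⊆ ρ α
    ⊆ρ α = ρ-greatest α α (λ φ _ α⊆φ → α⊆φ)

    -- image θ α = (α ∨ θ)/θ
    image : (θ α : Congruence A) → Congruence (A / θ)
    image θ α = (α ∨ θ) /ᶜ θ ∋ (λ p → base (inj₂ p))

    HasCBLP : Pred (Congruence A) (lsuc ℓ)
    HasCBLP θ = ∀ β → Complemented (Con (A / θ)) β →
                ∃[ α ] (Complemented (Con A) α × (image θ α ≋ β))

  module _ {𝑆} (A : Algebra 𝑆 ℓ) where

    Spec : Set (lsuc ℓ)
    Spec = ∃[ φ ] IsPrime {A = A} φ

    Max : Set (lsuc ℓ)
    Max = ∃[ φ ] IsMaximal {A = A} φ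

    Rad : Congruence A
    Rad = ⋂ IsMaximal

    D : Congruence A → Pred Spec ℓ
    D θ (φ , _) = ¬ (θ ⊆ φ)

    IsOpenSpec : Pred (Pred Spec ℓ) (lsuc ℓ)
    IsOpenSpec U = ∃[ θ ] (U ≐ D θ)

    K : Set (lsuc ℓ)
    K = ∃[ α ] Compact {A = A} α

    KClosedUnderCommutator : Set (lsuc ℓ)
    KClosedUnderCommutator = ∀ α β → Compact {A = A} α → Compact β → Compact [ α , β ]ᶜ

  module _ {𝑆} (V : Variety 𝑆 ℓ) (sd : Semidegenerate V) where

    collapses : ∀ B → B ∈ᵥ V → Algebra.HasOneElementSubalgebra B →
                ∀ x y → Algebra._≈_ B x y
    collapses B B∈V one x y = ¬¬-elim (λ x≉y → sd B B∈V (x , y , x≉y) one)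

    -- The algebra of V freely generated by two elements subject to the
    -- relations making the first of them a one-element subalgebra.
    private
      T : Set ℓ
      T = Term 𝑆 (Lift ℓ Bool)

      x₀ x₁ : T
      x₀ = var (lift false)
      x₁ = var (lift true)

      data _~_ : Rel T ℓ where
        ~-ax    : ∀ {s t} → Variety.Identity V s t → ∀ σ → (s ⟪ σ ⟫) ~ (t ⟪ σ ⟫)
        ~-idem  : ∀ f → op f (const x₀) ~ x₀
        ~-refl  : ∀ {s} → s ~ s
        ~-sym   : ∀ {s t} → s ~ t → t ~ s
        ~-trans : ∀ {s t u} → s ~ t → t ~ u → s ~ u
        ~-cong  : ∀ f {ss ts} → (∀ i → ss i ~ ts i) → op f ss ~ op f ts

      𝔽 : Algebra 𝑆 ℓ
      𝔽 = record
        { Carrier = T ; _≈_ = _~_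
        ; isEquivalence = record { refl = ~-refl ; sym = ~-sym ; trans = ~-trans }
        ; ⟦_⟧ = op ; ⟦⟧-cong = ~-cong ; nonempty = x₀ }

      eval-𝔽 : (t : Term 𝑆 ℕ) (σ : ℕ → T) → Algebra.eval 𝔽 t σ ~ (t ⟪ σ ⟫)
      eval-𝔽 (var x)   σ = ~-refl
      eval-𝔽 (op f ts) σ = ~-cong f (λ i → eval-𝔽 (ts i) σ)

      x₀~x₁ : x₀ ~ x₁
      x₀~x₁ = collapses 𝔽
        (λ s t st σ → ~-trans (eval-𝔽 s σ) (~-trans (~-ax st σ) (~-sym (eval-𝔽 t σ))))
        (x₀ , λ f xs h → ~-trans (~-cong f h) (~-idem f)) x₀ x₁

    ∇-compact : ∀ A → A ∈ᵥ V → Compact (∇ {A = A})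
    ∇-compact A A∈V = finitelyGenerated⇒compact (λ f → ⟦ f ⟧ (const e)) (const e) ∇ _
      (λ β h _ → Congruence.trans β (Congruence.sym β (e~ β h _)) (e~ β h _))
      where
      open Algebra A
      e : Carrier
      e = nonempty
      env : Carrier → Lift ℓ Bool → Carrier
      env y (lift false) = e
      env y (lift true)  = y
      module _ (β : Congruence A) (h : ∀ f → rel β (⟦ f ⟧ (const e)) e) (y : Carrier) where
        module β = Congruence β
        interpret : ∀ {s t} → s ~ t → rel β (eval s (env y)) (eval t (env y))
        interpret (~-ax {s} {t} st σ) = β.reflexive
          (≈.trans (eval-⟪⟫ s σ _) (≈.trans (A∈V s t st _) (≈.sym (eval-⟪⟫ t σ _))))
        interpret (~-idem f)    = h f
        interpret ~-refl        = β.refl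
        interpret (~-sym p)     = β.sym (interpret p)
        interpret (~-trans p q) = β.trans (interpret p) (interpret q)
        interpret (~-cong f ps) = β.compatible f (λ i → interpret (ps i))
        e~ : rel β e y
        e~ = interpret x₀~x₁

    module _ (A : Algebra 𝑆 ℓ) (A∈V : A ∈ᵥ V) where

      centralizes-∇ : ∀ γ δ → Centralizes ∇ γ δ → γ ⊆ δ
      centralizes-∇ γ δ C {x} {y} p = diag-invariant A γ δ (rel (∇ {A = A}))
        (λ _ → ∇ , tt , C)
        (collapses (𝔾 / Θ) (/-∈ᵥ V 𝔾 (𝔾-∈ᵥ V A∈V) Θ) (diag A.nonempty , one)
          (diag y) ((x , y) , p))
        (Congruence.refl δ)
        where
        open Graph A γ
        module A = Algebra A
        Θ : Congruence 𝔾
        Θ = Cg 𝔾 (Diag (rel (∇ {A = A})))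
        one : Algebra.IsSubuniverse (𝔾 / Θ) (λ u → rel Θ u (diag A.nonempty))
        one f us h = trans (comp f h) (trans (equal (A.≈.refl , A.≈.refl))
          (base (diagonal {x = A.⟦ f ⟧ (const A.nonempty)} tt)))

      -- The quotient K(A)/≡ is formed by taking ρ α ≋ ρ β as the equality.
      Reticulation : KClosedUnderCommutator A → BoundedLattice (lsuc ℓ) ℓ ℓ
      Reticulation closed = record
        { Carrier = K A
        ; _≈_ = λ (α , _) (β , _) → ρ α ≋ ρ β
        ; _≤_ = λ (α , _) (β , _) → ρ α ⊆ ρ β
        ; _∨_ = λ (α , cα) (β , cβ) → α ∨ β , ∨-compact α β cα cβ
        ; _∧_ = λ (α , cα) (β , cβ) → [ α , β ]ᶜ , closed α β cα cβ
        ; ⊤ = ∇ , ∇-compact A A∈V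
        ; ⊥ = Δ , Δ-compact
        ; isBoundedLattice = record
          { isLattice = record
            { isPartialOrder = record
              { isPreorder = record
                { isEquivalence = record
                  { refl  = id , id
                  ; sym   = swap
                  ; trans = λ (p , q) (p′ , q′) → (λ z → p′ (p z)) , (λ z → q (q′ z))
                  }
                ; reflexive = proj₁
                ; trans     = λ p q z → q (p z)
                }
              ; antisym = _,_
              }
            ; supremum = λ (α , _) (β , _) →
                ρ-mono α (α ∨ β) (λ p → base (inj₁ p)) ,
                ρ-mono β (α ∨ β) (λ p → base (inj₂ p)) ,
                λ (χ , _) p q → ρ-greatest (ρ (α ∨ β)) χ (λ φ φ-prime χ⊆φ →
                  ρ-lower (α ∨ β) φ φ-prime (∨-least α β φ
                    (λ z → ρ-lower χ φ φ-prime χ⊆φ (p (⊆ρ α z)))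
                    (λ z → ρ-lower χ φ φ-prime χ⊆φ (q (⊆ρ β z)))))
            ; infimum = λ (α , _) (β , _) →
                ρ-mono [ α , β ]ᶜ α (commutator⊆ˡ α β) ,
                ρ-mono [ α , β ]ᶜ β (commutator⊆ʳ α β) ,
                λ (χ , _) p q → ρ-greatest (ρ χ) [ α , β ]ᶜ (λ φ φ-prime αβ⊆φ z →
                  prime-elim φ φ-prime α β αβ⊆φ
                    (λ α⊆φ → ρ-lower α φ φ-prime α⊆φ (p z))
                    (λ β⊆φ → ρ-lower β φ φ-prime β⊆φ (q z)))
            }
          ; maximum = λ (α , _) → ρ-mono α ∇ _
          ; minimum = λ (α , _) → ρ-mono Δ α (Congruence.reflexive α)
          }
        }

  module _ {𝑆} (V : Variety 𝑆 ℓ) (cm : CongruenceModular V) (sd : Semidegenerate V)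
           (A : Algebra 𝑆 ℓ) (A∈V : A ∈ᵥ V) where

    commutator-centralizes′ : ∀ α β δ → [ α , β ]ᶜ ⊆ δ → Centralizes α β δ
    commutator-centralizes′ α β δ =
      centralizes-mono A V cm A∈V α β [ α , β ]ᶜ δ (commutator-centralizes α β)

    -- If α ∨ β = ∇, then γ = [ α ∨ β , γ ] = [ α , γ ] ∨ [ β , γ ].
    cover : ∀ α β γ δ → ∇ ⊆ α ∨ β → [ α , γ ]ᶜ ⊆ δ → [ β , γ ]ᶜ ⊆ δ → γ ⊆ δ
    cover α β γ δ ∇⊆ p q = centralizes-∇ V sd A A∈V γ δ
      (λ t a a′ b b′ _ → centralizes-∨ A α β γ δ
        (commutator-centralizes′ α γ δ p) (commutator-centralizes′ β γ δ q)
        t a a′ b b′ (λ _ → ∇⊆ tt))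

    max⇒prime : ∀ φ → IsMaximal φ → IsPrime φ
    max⇒prime φ (φ≠∇ , max) = φ≠∇ , prime
      where
      prime : ∀ α β → [ α , β ]ᶜ ⊆ φ → (α ⊆ φ) ⊎ (β ⊆ φ)
      prime α β h with em₀ {∇ ⊆ α ∨ φ}
      ... | yes p = inj₂ (cover α φ β φ p h (commutator⊆ˡ φ β))
      ... | no ¬p = inj₁ (λ z → max (α ∨ φ) (λ w → base (inj₂ w)) ¬p (base (inj₁ z)))

    IsCompl : Rel (Congruence A) ℓ
    IsCompl = IsComplement (Con A)

    compl-sym : ∀ α β → IsCompl α β → IsCompl β α
    compl-sym α β (j , m) =
      (_ , λ z → ∨-least α β (β ∨ α) (λ w → base (inj₂ w)) (λ w → base (inj₁ w)) (proj₂ j z)) ,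
      (λ (p , q) → proj₁ m (q , p)) , λ z → Congruence.reflexive (β ∧ α) z

    disjoint : ∀ α α′ → IsCompl α α′ → ∀ γ δ → γ ⊆ α′ → [ α , γ ]ᶜ ⊆ δ
    disjoint α α′ (_ , m) γ δ γ⊆α′ z =
      Congruence.reflexive δ (proj₁ m (commutator⊆ˡ α γ z , γ⊆α′ (commutator⊆ʳ α γ z)))

    ∨-compl : ∀ α α′ β β′ → IsCompl α α′ → IsCompl β β′ → IsCompl (α ∨ β) (α′ ∧ β′)
    ∨-compl α α′ β β′ cα cβ = (_ , join) , meet , Congruence.reflexive ((α ∨ β) ∧ (α′ ∧ β′))
      where
      J : Congruence A
      J = (α ∨ β) ∨ (α′ ∧ β′)
      β′⊆J : β′ ⊆ J
      β′⊆J = cover α α′ β′ J (proj₂ (proj₁ cα))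
        (λ z → base (inj₁ (base (inj₁ (commutator⊆ˡ α β′ z)))))
        (λ z → base (inj₂ (commutator⊆ˡ α′ β′ z , commutator⊆ʳ α′ β′ z)))
      join : ∇ ⊆ J
      join z = ∨-least β β′ J (λ w → base (inj₁ (base (inj₂ w)))) β′⊆J (proj₂ (proj₁ cβ) z)
      W : Congruence A
      W = (α′ ∧ β) ∨ α
      α∨β⊆W : α ∨ β ⊆ W
      α∨β⊆W = ∨-least α β W (λ z → base (inj₂ z))
        (cover α α′ β W (proj₂ (proj₁ cα))
          (λ z → base (inj₂ (commutator⊆ˡ α β z)))
          (λ z → base (inj₁ (commutator⊆ˡ α′ β z , commutator⊆ʳ α′ β z))))
      meet : (α ∨ β) ∧ (α′ ∧ β′) ⊆ Δ
      meet (w , p , q) = proj₁ (proj₂ cβ)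
        (∨-least (α′ ∧ β) (α ∧ α′) β proj₂
           (λ z → Congruence.reflexive β (proj₁ (proj₂ cα) z))
           (proj₂ (cm A A∈V (α′ ∧ β) α α′ proj₁) (α∨β⊆W w , p)) , q)

    ∧-compl : ∀ α α′ β β′ → IsCompl α α′ → IsCompl β β′ → IsCompl (α ∧ β) (α′ ∨ β′)
    ∧-compl α α′ β β′ cα cβ =
      compl-sym (α′ ∨ β′) (α ∧ β)
        (∨-compl α′ α β′ β (compl-sym α α′ cα) (compl-sym β β′ cβ))

    distrib : ∀ β β′ γ γ′ → IsCompl β β′ → IsCompl γ γ′ → ∀ α →
              α ∧ (β ∨ γ) ⊆ (α ∧ β) ∨ (α ∧ γ)
    distrib β β′ γ γ′ cβ cγ α =
      cover (β ∨ γ) (β′ ∧ γ′) μ R (proj₂ (proj₁ cβγ))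
        (commutator-least (β ∨ γ) μ R (centralizes-∨ A β γ μ R
          (commutator-centralizes′ β μ R (λ z →
            base (inj₁ (proj₁ (commutator⊆ʳ β μ z) , commutator⊆ˡ β μ z))))
          (commutator-centralizes′ γ μ R (λ z →
            base (inj₂ (proj₁ (commutator⊆ʳ γ μ z) , commutator⊆ˡ γ μ z))))))
        (disjoint (β′ ∧ γ′) (β ∨ γ) (compl-sym (β ∨ γ) (β′ ∧ γ′) cβγ) μ R proj₂)
      where
      μ R : Congruence A
      μ = α ∧ (β ∨ γ)
      R = (α ∧ β) ∨ (α ∧ γ)
      cβγ : IsCompl (β ∨ γ) (β′ ∧ γ′)
      cβγ = ∨-compl β β′ γ γ′ cβ cγ

    -- Elements carry a complement, which equality disregards: it is unique.
    BCon : BooleanAlgebra (lsuc ℓ) ℓ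
    BCon = toBooleanAlgebra lattice
      (λ (α , _) (β , β′ , cβ) (γ , γ′ , cγ) → distrib β β′ γ γ′ cβ cγ α)
      (λ (α , α′ , c) → α′ , α , compl-sym α α′ c)
      (λ (_ , _ , c) → proj₂ (proj₁ c))
      (λ (_ , _ , c) → proj₁ (proj₂ c))
      where
      lattice : BoundedLattice (lsuc ℓ) ℓ ℓ
      lattice = record
        { Carrier = ∃[ α ] Complemented (Con A) α
        ; _≈_ = λ (α , _) (β , _) → α ≋ β
        ; _≤_ = λ (α , _) (β , _) → α ⊆ β
        ; _∨_ = λ (α , α′ , cα) (β , β′ , cβ) → α ∨ β , α′ ∧ β′ , ∨-compl α α′ β β′ cα cβ
        ; _∧_ = λ (α , α′ , cα) (β , β′ , cβ) → α ∧ β , α′ ∨ β′ , ∧-compl α α′ β β′ cα cβ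
        ; ⊤ = ∇ , Δ , (_ , λ z → base (inj₁ z)) , proj₂ , λ z → tt , z
        ; ⊥ = Δ , ∇ , (_ , λ z → base (inj₂ z)) , proj₁ , λ z → z , tt
        ; isBoundedLattice = record
          { isLattice = record
            { isPartialOrder = record
              { isPreorder = record
                { isEquivalence = record
                  { refl  = id , id
                  ; sym   = swap
                  ; trans = λ (p , q) (p′ , q′) → (λ z → p′ (p z)) , (λ z → q (q′ z))
                  }
                ; reflexive = proj₁
                ; trans     = λ p q z → q (p z)
                }
              ; antisym = _,_
              }
            ; supremum = λ (α , _) (β , _) →
                (λ p → base (inj₁ p)) , (λ p → base (inj₂ p)) , λ (γ , _) → ∨-least α β γ
            ; infimum  = λ _ _ → proj₁ , proj₂ , λ _ p q z → p z , q z
            }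
          ; maximum = _
          ; minimum = λ (α , _) → Congruence.reflexive α
          }
        }

    complemented⇒compact : ∀ α → Complemented (Con A) α → Compact α
    complemented⇒compact α (α′ , c) {I} θ α⊆⋁θ = restrict fin , α⊆
      where
      θ′ : ⊤ {ℓ} ⊎ I → Congruence A
      θ′ = [ const α′ , θ ]
      ⋁θ⊆ : ⋁ θ ⊆ ⋁ θ′
      ⋁θ⊆ = Cg-least _ (⋁ θ′) (λ (i , p) → base (inj₂ i , p))
      covered : ∇ ⊆ ⋁ θ′
      covered z = ∨-least α α′ (⋁ θ′) (λ p → ⋁θ⊆ (α⊆⋁θ p)) (λ p → base (inj₁ tt , p))
        (proj₂ (proj₁ c) z)
      fin : List (⊤ ⊎ I)
      fin = proj₁ (∇-compact V sd A A∈V θ′ covered)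
      restrict : List (⊤ {ℓ} ⊎ I) → List I
      restrict []            = []
      restrict (inj₁ _ ∷ js) = restrict js
      restrict (inj₂ i ∷ js) = i ∷ restrict js
      restrict-∈ : ∀ {i} js → inj₂ i ∈ js → i ∈ restrict js
      restrict-∈ (inj₁ _ ∷ js) (there p)   = restrict-∈ js p
      restrict-∈ (inj₂ _ ∷ js) (here refl) = here refl
      restrict-∈ (inj₂ _ ∷ js) (there p)   = there (restrict-∈ js p)
      F : Congruence A
      F = ⋁ᶠ θ (restrict fin)
      split : ∀ {x y} → (Σ[ ji ∈ (∃[ j ] (j ∈ fin)) ] rel (θ′ (proj₁ ji)) x y) → rel (α′ ∨ F) x y
      split ((inj₁ _ , _) , p)  = base (inj₁ p)
      split ((inj₂ i , i∈) , p) = base (inj₂ (base ((i , restrict-∈ fin i∈) , p)))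
      α⊆ : α ⊆ F
      α⊆ = cover α′ F α F
        (λ z → Cg-least _ (α′ ∨ F) split (proj₂ (∇-compact V sd A A∈V θ′ covered) z))
        (disjoint α′ α (compl-sym α α′ c) α F id)
        (commutator⊆ˡ F α)

    -- The canonical map λ_A restricted to complemented congruences.
    λᴮ : BooleanAlgebra.Carrier BCon → K A
    λᴮ (α , c) = α , complemented⇒compact α c

    PreservesBooleanCenter : KClosedUnderCommutator A → Set (lsuc ℓ)
    PreservesBooleanCenter closed =
      ∀ x → Complemented (Reticulation V sd A A∈V closed) x →
      ∃[ α ] BoundedLattice._≈_ (Reticulation V sd A A∈V closed) (λᴮ α) x

    max→spec : Max A → Spec A
    max→spec (φ , m) = φ , max⇒prime φ m

    Max∩_ : Pred (Spec A) ℓ → Pred (Max A) ℓ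
    Max∩ U = max→spec ⊢ U

    IsOpenMax : Pred (Pred (Max A) ℓ) (lsuc ℓ)
    IsOpenMax W = ∃[ U ] (IsOpenSpec A U × (W ≐ Max∩ U))

    IsClopenMax : Pred (Pred (Max A) ℓ) (lsuc ℓ)
    IsClopenMax W = IsOpenMax W × IsOpenMax (U.∁ W)

    D-open : ∀ θ {W} → W ≐ (Max∩ D A θ) → IsOpenMax W
    D-open θ eq = D A θ , (θ , id , id) , eq

    open-D : ∀ {W} → IsOpenMax W → ∃[ θ ] (W ≐ (Max∩ D A θ))
    open-D (U , (θ , p , q) , r , s) = θ , (λ z → p (r z)) , (λ z → s (q z))

    ∪-open : ∀ {W W′} → IsOpenMax W → IsOpenMax W′ → IsOpenMax (W U.∪ W′)
    ∪-open {W} {W′} o o′ =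
      let (θ , p , q) = open-D o ; (θ′ , p′ , q′) = open-D o′ in
      D-open (θ ∨ θ′) (
        (λ { (inj₁ w) h → p w (λ z → h (base (inj₁ z)))
           ; (inj₂ w) h → p′ w (λ z → h (base (inj₂ z))) }) ,
        λ {(φ , m)} h → case φ m θ θ′ h q q′)
      where
      case : ∀ φ m θ θ′ → ¬ (θ ∨ θ′ ⊆ φ) →
             (∀ {x} → (Max∩ D A θ) x → W x) → (∀ {x} → (Max∩ D A θ′) x → W′ x) →
             (W U.∪ W′) (φ , m)
      case φ m θ θ′ h q q′ with em₀ {θ ⊆ φ}
      ... | no ¬p = inj₁ (q ¬p)
      ... | yes p = inj₂ (q′ (λ p′ → h (∨-least θ θ′ φ p p′)))

    ∩-open : ∀ {W W′} → IsOpenMax W → IsOpenMax W′ → IsOpenMax (W U.∩ W′)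
    ∩-open {W} {W′} o o′ =
      let (θ , p , q) = open-D o ; (θ′ , p′ , q′) = open-D o′ in
      D-open [ θ , θ′ ]ᶜ (
        (λ {(φ , m)} (w , w′) h →
          prime-elim φ (max⇒prime φ m) θ θ′ h (p w) (p′ w′)) ,
        λ h → q (λ r → h (λ z → r (commutator⊆ˡ θ θ′ z))) ,
              q′ (λ r → h (λ z → r (commutator⊆ʳ θ θ′ z))))

    ≐-open : ∀ {W W′} → W ≐ W′ → IsOpenMax W → IsOpenMax W′
    ≐-open (p , q) (U , o , r , s) = U , o , (λ z → r (q z)) , (λ z → p (s z))

    full-open : IsOpenMax (λ _ → ⊤)
    full-open = D-open ∇ ((λ { {φ , m} _ → proj₁ m }) , _)

    empty-open : IsOpenMax (λ _ → Lift ℓ ⊥)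
    empty-open = D-open Δ ((λ ()) , λ { {φ , m} h → ⊥-elim (h (Congruence.reflexive φ)) })

    Clop : BooleanAlgebra (lsuc ℓ) (lsuc ℓ)
    Clop = toBooleanAlgebra lattice
      (λ _ _ _ (x , yz) → [ (λ y → inj₁ (x , y)) , (λ z → inj₂ (x , z)) ] yz)
      (λ (W , o , o′) → U.∁ W , o′ , ≐-open ((λ w ¬w → ¬w w) , ¬¬-elim) o)
      (λ (W , _) {x} _ → lem W x)
      (λ _ (w , ¬w) → lift (¬w w))
      where
      lem : ∀ (W : Pred (Max A) ℓ) x → W x ⊎ ¬ W x
      lem W x with em₀ {W x}
      ... | yes p = inj₁ p
      ... | no ¬p = inj₂ ¬p
      lattice : BoundedLattice (lsuc ℓ) (lsuc ℓ) (lsuc ℓ)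
      lattice = record
        { Carrier = ∃[ W ] IsClopenMax W
        ; _≈_ = λ (W , _) (W′ , _) → W ≐ W′
        ; _≤_ = λ (W , _) (W′ , _) → W U.⊆ W′
        ; _∨_ = λ (W , o , c) (W′ , o′ , c′) → W U.∪ W′ , ∪-open o o′ ,
            ≐-open ((λ (p , q) → [ p , q ]) , λ h → (λ w → h (inj₁ w)) , (λ w → h (inj₂ w)))
                   (∩-open c c′)
        ; _∧_ = λ (W , o , c) (W′ , o′ , c′) → W U.∩ W′ , ∩-open o o′ ,
            ≐-open ([ (λ p (w , _) → p w) , (λ q (_ , w) → q w) ] ,
                    λ {x} h → [ (λ w → inj₂ (λ w′ → h (w , w′))) , inj₁ ] (lem W x))
                   (∪-open c c′)
        ; ⊤ = (λ _ → ⊤) , full-open , ≐-open ((λ ()) , λ h → ⊥-elim (h tt)) empty-open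
        ; ⊥ = (λ _ → Lift ℓ ⊥) , empty-open , ≐-open ((λ _ ()) , _) full-open
        ; isBoundedLattice = record
          { isLattice = record
            { isPartialOrder = record
              { isPreorder = record
                { isEquivalence = record
                  { refl  = id , id
                  ; sym   = swap
                  ; trans = λ (p , q) (p′ , q′) → (λ z → p′ (p z)) , (λ z → q (q′ z))
                  }
                ; reflexive = proj₁
                ; trans     = λ p q z → q (p z)
                }
              ; antisym = _,_
              }
            ; supremum = λ _ _ → inj₁ , inj₂ , λ _ p q → [ p , q ]
            ; infimum  = λ _ _ → proj₁ , proj₂ , λ _ p q z → p z , q z
            }
          ; maximum = _
          ; minimum = λ _ ()
          }
        }

    g : BooleanAlgebra.Carrier BCon → BooleanAlgebra.Carrier Clop
    g (α , α′ , c) = Max∩ D A α , D-open α (id , id) , D-open α′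
      ( (λ {(φ , m)} h α′⊆φ → h (λ α⊆φ → proj₁ m (λ z → ∨-least α α′ φ α⊆φ α′⊆φ (proj₂ (proj₁ c) z))))
      , (λ {(φ , m)} h ¬α⊆φ →
          prime-elim φ (max⇒prime φ m) α α′ (disjoint α α′ c α′ φ id) ¬α⊆φ h))

  record StandingAssumption {𝑆} (V : Variety 𝑆 ℓ)
           (cm : CongruenceModular V) (sd : Semidegenerate V) : Set (lsuc ℓ) where
    field
      K-closed        : ∀ B → B ∈ᵥ V → KClosedUnderCommutator B
      preservesCenter : ∀ B (B∈V : B ∈ᵥ V) →
                        PreservesBooleanCenter V cm sd B B∈V (K-closed B B∈V)

{-# OPTIONS --safe #-}
module Submission where

-- Every proper congruence lies below a maximal one, because ∇ is compact.
-- Hence θ ∨ θ′ = ∇ as soon as no maximal congruence contains both, and a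
-- congruence lies below Rad(A) as soon as it lies below all maximal ones.
-- Therefore a clopen set Max ∩ D(θ) with complement Max ∩ D(θ′) amounts to a
-- complementary pair (θ ∨ Rad)/Rad, (θ′ ∨ Rad)/Rad in Con(A/Rad), and a lifting
-- of the former along Rad is the same thing as a g-preimage of the clopen set.

open import Level using (suc; lift)
open import Axiom.ExcludedMiddle using (ExcludedMiddle)
open import Algebra.Lattice.Bundles using (BooleanAlgebra)
open import Algebra.Lattice.Morphism.Structures using (IsLatticeIsomorphism)
open import Data.List.Base using (List; []; _∷_)
open import Data.List.Membership.Propositional using (_∈_)
open import Data.List.Relation.Unary.Any using (here; there)
open import Data.Product.Base using (Σ-syntax; ∃-syntax; _×_; _,_; proj₁; proj₂)
open import Data.Sum.Base using (_⊎_; inj₁; inj₂; [_,_])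
open import Data.Unit.Polymorphic.Base using (⊤; tt)
open import Function.Base using (_∘_; const; id)
open import Function.Bundles using (_⇔_; mk⇔)
open import Function.Definitions using (Injective; Surjective)
open import Relation.Binary.Bundles using (Poset)
open import Relation.Binary.PropositionalEquality.Core using (refl)
open import Relation.Nullary using (¬_; yes; no)
open import Relation.Unary using (Pred)
open import Defs

open Congruence using (rel)

-- Maximal congruences via Zorn's lemma.

module _ {c ℓ₁ ℓ₂} (P : Poset c ℓ₁ ℓ₂) where
  open Poset P using (Carrier; _≤_) renaming (refl to ≤-refl; trans to ≤-trans)

  -- Compactness extracts finitely many members of a chain, and the greatest of them absorbs their
  -- join. `i₀` covers the empty list.
  chain-finite-bound : ∀ {i} {I : Set i} (x : I → Carrier) →
    (∀ j k → (x j ≤ x k) ⊎ (x k ≤ x j)) → I → (is : List I) →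
    ∃[ k ] (∀ {j} → j ∈ is → x j ≤ x k)
  chain-finite-bound x total i₀ [] = i₀ , λ ()
  chain-finite-bound x total i₀ (i ∷ is) with chain-finite-bound x total i₀ is
  ... | k , bound with total i k
  ...   | inj₁ i≤k = k , λ { (here refl) → i≤k ; (there j∈) → bound j∈ }
  ...   | inj₂ k≤i = i , λ { (here refl) → ≤-refl ; (there j∈) → ≤-trans (bound j∈) k≤i }

module _ {𝑆 ℓ} {A : Algebra 𝑆 ℓ} (χ : Congruence A) where

  properAbove : Poset (suc ℓ) ℓ ℓ
  properAbove = record
    { Carrier = Σ[ ψ ∈ Congruence A ] ((χ ⊆ ψ) × ¬ (∇ ⊆ ψ))
    ; _≈_ = λ (φ , _) (ψ , _) → φ ≋ ψ
    ; _≤_ = λ (φ , _) (ψ , _) → φ ⊆ ψ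
    ; isPartialOrder = record
      { isPreorder = record
        { isEquivalence = record
          { refl  = id , id
          ; sym   = λ (p , q) → q , p
          ; trans = λ (p , q) (p′ , q′) → (λ z → p′ (p z)) , (λ z → q (q′ z))
          }
        ; reflexive = proj₁
        ; trans     = λ p q z → q (p z)
        }
      ; antisym = _,_
      }
    }

module Maximal {ℓ} (em : ExcludedMiddle (suc ℓ)) (zorn : Zorn (suc ℓ) ℓ ℓ (suc ℓ))
               {𝑆} {A : Algebra 𝑆 ℓ} (∇-compact : Compact (∇ {A = A})) where
  open Classical em using (‖_‖; ‖‖⁺; ‖‖⁻; ¬¬-elim)

  module _ (χ : Congruence A) (χ-proper : ¬ (∇ ⊆ χ)) where
    open Poset (properAbove χ) using (Carrier; _≤_)

    -- C lives one universe too high to index a join of congruences; the pairs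
    -- related by some member of C index a subfamily with the same union.
    chain-bound : (C : Pred Carrier (suc ℓ)) →
      (∀ φ ψ → C φ → C ψ → (φ ≤ ψ) ⊎ (ψ ≤ φ)) → ∃[ υ ] (∀ φ → C φ → φ ≤ υ)
    chain-bound C chain = (⋁ θ , (λ p → base (inj₁ tt , p)) , proper) ,
        λ φ Cφ {x} {y} p →
          let i = x , y , ‖‖⁺ (φ , Cφ , p) in base (inj₂ i , proj₂ (proj₂ (‖‖⁻ (proj₂ (proj₂ i)))))
      where
      I : Set ℓ
      I = Σ[ x ∈ Algebra.Carrier A ] Σ[ y ∈ Algebra.Carrier A ]
          ‖ (∃[ φ ] (C φ × rel (proj₁ φ) x y)) ‖
      member : I → ∃[ φ ] C φ
      member (_ , _ , w) = let (φ , Cφ , _) = ‖‖⁻ w in φ , Cφ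
      -- The extra index stands for `χ`, which keeps the join above `χ` even for an empty chain.
      elem : ⊤ {ℓ} ⊎ I → Carrier
      elem = [ const (χ , id , χ-proper) , proj₁ ∘ member ]
      θ : ⊤ {ℓ} ⊎ I → Congruence A
      θ = proj₁ ∘ elem
      total : ∀ j k → (elem j ≤ elem k) ⊎ (elem k ≤ elem j)
      total (inj₁ _) k        = inj₁ (proj₁ (proj₂ (elem k)))
      total (inj₂ i) (inj₁ _) = inj₂ (proj₁ (proj₂ (elem (inj₂ i))))
      total (inj₂ i) (inj₂ k) = chain _ _ (proj₂ (member i)) (proj₂ (member k))
      proper : ¬ (∇ ⊆ ⋁ θ)
      proper ∇⊆ =
        -- If the join were `∇`, compactness would put `∇` below a single proper member.
        let (is , ∇⊆fin) = ∇-compact θ ∇⊆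
            (k , bound)  = chain-finite-bound (properAbove χ) elem total (inj₁ tt) is
        in proj₂ (proj₂ (elem k))
             (λ z → Cg-least _ (θ k) (λ ((_ , j∈) , p) → bound j∈ p) (∇⊆fin z))

    maximal-above : ∃[ φ ] (IsMaximal φ × (χ ⊆ φ))
    maximal-above =
      let ((φ , χ⊆φ , φ-proper) , max) = zorn (properAbove χ) chain-bound
      in φ , (φ-proper , λ ψ φ⊆ψ ψ-proper →
                proj₁ (max (ψ , (λ z → φ⊆ψ (χ⊆φ z)) , ψ-proper) φ⊆ψ)) , χ⊆φ

  no-maximal⇒∇ : ∀ χ → (∀ φ → IsMaximal φ → ¬ (χ ⊆ φ)) → ∇ ⊆ χ
  no-maximal⇒∇ χ none = ¬¬-elim {P = ∇ ⊆ χ} λ χ-proper →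
    let (φ , m , χ⊆φ) = maximal-above χ χ-proper in none φ m χ⊆φ

-- Congruences of a quotient algebra.

module _ {𝑆 ℓ} {A : Algebra 𝑆 ℓ} (θ : Congruence A) where

  lift-congruence : Congruence (A / θ) → Congruence A
  lift-congruence β = record
    { rel = rel β ; isEquivalence = β.isEquivalence
    ; reflexive = λ p → β.reflexive (Congruence.reflexive θ p) ; compatible = β.compatible }
    where module β = Congruence β

  ∨⊆∨-quotient : ∀ α β (α′ β′ : Congruence (A / θ)) →
    α ⊆ lift-congruence α′ → β ⊆ lift-congruence β′ → α ∨ β ⊆ lift-congruence (α′ ∨ β′)
  ∨⊆∨-quotient α β α′ β′ p q =
    ∨-least α β (lift-congruence (α′ ∨ β′)) (λ z → base (inj₁ (p z))) (λ z → base (inj₂ (q z)))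

  -- Generation over `A / θ` also admits the pairs of `θ` as equalities. They already lie in the
  -- lift of `α`, so the join formed in `A` is itself a congruence of `A / θ`.
  ∨-quotient⊆∨ : ∀ (α β : Congruence (A / θ)) →
    θ ⊆ lift-congruence α → lift-congruence (α ∨ β) ⊆ lift-congruence α ∨ lift-congruence β
  ∨-quotient⊆∨ α β θ⊆α =
    Cg-least _ ((lift-congruence α ∨ lift-congruence β) /ᶜ θ ∋ (λ z → base (inj₁ (θ⊆α z)))) base

module Lifting {ℓ} (em : ExcludedMiddle (suc ℓ)) (zorn : Zorn (suc ℓ) ℓ ℓ (suc ℓ))
               {𝑆} (V : Variety 𝑆 ℓ) (cm : CongruenceModular V) (sd : Semidegenerate V)
               (A : Algebra 𝑆 ℓ) (A∈V : A ∈ᵥ V) where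
  open Classical em
  open Maximal em zorn (∇-compact V sd A A∈V)

  private
    module B = BooleanAlgebra (BCon V cm sd A A∈V)
    module C = BooleanAlgebra (Clop V cm sd A A∈V)

    R : Congruence A
    R = Rad A

    G : B.Carrier → C.Carrier
    G = g V cm sd A A∈V

  -- Basic open sets of the maximal spectrum.

  Rad⊆ : ∀ φ → IsMaximal φ → R ⊆ φ
  Rad⊆ = ⋂-lower IsMaximal

  MaxD : Congruence A → Pred (Max A) ℓ
  MaxD θ (φ , _) = ¬ (θ ⊆ φ)

  -- Every maximal congruence contains `R`, so joining with `R` does not affect which of them
  -- contain `θ`.
  image-MaxD : ∀ α θ → α ⊆ θ ∨ R → ∀ {m} → MaxD α m → MaxD θ m
  image-MaxD α θ α⊆ {φ , m} α⊈φ θ⊆φ = α⊈φ (λ z → ∨-least θ R φ θ⊆φ (Rad⊆ φ m) (α⊆ z))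

  prime-MaxD : ∀ α β m → MaxD α m → MaxD β m → ¬ ([ α , β ]ᶜ ⊆ proj₁ m)
  prime-MaxD α β (φ , m) α⊈φ β⊈φ αβ⊆φ =
    prime-elim φ (max⇒prime V cm sd A A∈V φ m) α β αβ⊆φ α⊈φ β⊈φ

  MaxD-cover⇒∇ : ∀ α β → (∀ m → ¬ MaxD α m → MaxD β m) → ∇ ⊆ α ∨ β
  MaxD-cover⇒∇ α β cov = no-maximal⇒∇ (α ∨ β) λ φ m ⊆φ →
    cov (φ , m) (λ α⊈φ → α⊈φ (λ z → ⊆φ (base (inj₁ z)))) (λ z → ⊆φ (base (inj₂ z)))

  ∇-MaxD : ∀ α β → ∇ ⊆ α ∨ β → ∀ m → ¬ MaxD α m → MaxD β m
  ∇-MaxD α β ∇⊆ (φ , φ-proper , _) ¬α⊈φ β⊆φ =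
    ¬α⊈φ (λ α⊆φ → φ-proper (λ z → ∨-least α β φ α⊆φ β⊆φ (∇⊆ z)))

  -- A maximal congruence containing `α` contains `β`, hence not `β′`; so `α ∨ β′` is `∇`. Then `β`
  -- lies below any congruence containing `[ α , β ]ᶜ` and `[ β′ , β ]ᶜ`, which are below `α` and
  -- `β ∧ β′`. Injectivity of `g` uses this with meet `Δ`, lifting also with meet below `R`.
  MaxD-reflects : ∀ α β β′ δ → ∇ ⊆ β ∨ β′ → α ⊆ δ → β ∧ β′ ⊆ δ →
                  (∀ m → MaxD β m → MaxD α m) → β ⊆ δ
  MaxD-reflects α β β′ δ ∇⊆ α⊆δ β∧β′⊆δ β⇒α =
    cover V cm sd A A∈V α β′ β δ
      (MaxD-cover⇒∇ α β′ λ m ¬α → ∇-MaxD β β′ ∇⊆ m (λ β⊈ → ¬α (β⇒α m β⊈)))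
      (λ z → α⊆δ (commutator⊆ˡ α β z))
      (λ z → β∧β′⊆δ (commutator⊆ʳ β′ β z , commutator⊆ˡ β′ β z))

  -- The complement is `MaxD β′`: no maximal congruence contains both, and each contains one by
  -- primeness, as `[ β , β′ ]ᶜ` is below `R`.
  clopen-MaxD : ∀ β β′ → ∇ ⊆ β ∨ β′ → β ∧ β′ ⊆ R → IsClopenMax V cm sd A A∈V (MaxD β)
  clopen-MaxD β β′ ∇⊆ β∧β′⊆R =
    D-open V cm sd A A∈V β (id , id) ,
    D-open V cm sd A A∈V β′
      ( (λ {m} → ∇-MaxD β β′ ∇⊆ m)
      , λ {m} β′⊈ β⊈ → prime-MaxD β β′ m β⊈ β′⊈ (λ z →
          Rad⊆ (proj₁ m) (proj₂ m) (β∧β′⊆R (commutator⊆ˡ β β′ z , commutator⊆ʳ β β′ z))))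

  clopen⇒complemented : ∀ θ θ′ → (∀ m → ¬ MaxD θ m → MaxD θ′ m) →
    (∀ m → MaxD θ′ m → ¬ MaxD θ m) → IsComplement (Con (A / R)) (image R θ) (image R θ′)
  clopen⇒complemented θ θ′ cov disj =
    (_ , λ _ → ∨⊆∨-quotient R θ θ′ (image R θ) (image R θ′)
                 (λ z → base (inj₁ z)) (λ z → base (inj₁ z)) (MaxD-cover⇒∇ θ θ′ cov tt)) ,
    -- The bottom of `Con (A / R)` has `R` as its relation, an intersection, so the meet is tested
    -- at one maximal congruence at a time.
    ⋂-greatest IsMaximal ((θ ∨ R) ∧ (θ′ ∨ R)) meet ,
    Congruence.reflexive (image R θ ∧ image R θ′)
    where
    meet : ∀ φ → IsMaximal φ → (θ ∨ R) ∧ (θ′ ∨ R) ⊆ φ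
    meet φ m {x} {y} (p , p′) = ¬¬-elim λ ¬φxy → disj (φ , m)
      (λ θ′⊆φ → ¬φxy (∨-least θ′ R φ θ′⊆φ (Rad⊆ φ m) p′))
      (λ θ⊆φ → ¬φxy (∨-least θ R φ θ⊆φ (Rad⊆ φ m) p))

  -- `g` as an injective Boolean morphism.

  g-cong : ∀ x y → x B.≈ y → G x C.≈ G y
  g-cong _ _ (p , q) = (λ h r → h (λ z → r (p z))) , (λ h r → h (λ z → r (q z)))

  g-∨-homo : ∀ x y → G (x B.∨ y) C.≈ (G x C.∨ G y)
  g-∨-homo (α , _) (β , _) =
    (λ {(φ , _)} h → split φ h) ,
    [ (λ h r → h (λ z → r (base (inj₁ z)))) , (λ h r → h (λ z → r (base (inj₂ z)))) ]
    where
    split : ∀ φ → ¬ (α ∨ β ⊆ φ) → ¬ (α ⊆ φ) ⊎ ¬ (β ⊆ φ)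
    split φ h with em₀ {α ⊆ φ}
    ... | no α⊈φ  = inj₁ α⊈φ
    ... | yes α⊆φ = inj₂ (λ β⊆φ → h (∨-least α β φ α⊆φ β⊆φ))

  g-∧-homo : ∀ x y → G (x B.∧ y) C.≈ (G x C.∧ G y)
  g-∧-homo (α , _) (β , _) =
    (λ h → (λ r → h (λ z → r (proj₁ z))) , (λ r → h (λ z → r (proj₂ z)))) ,
    λ {m} (α⊈ , β⊈) ⊆φ → prime-MaxD α β m α⊈ β⊈
      (λ z → ⊆φ (commutator⊆ˡ α β z , commutator⊆ʳ α β z))

  g-¬-homo : ∀ x → G (B.¬ x) C.≈ (C.¬ G x)
  g-¬-homo (α , α′ , c) =
    (λ {m} α′⊈ α⊈ → prime-MaxD α α′ m α⊈ α′⊈ (disjoint V cm sd A A∈V α α′ c α′ (proj₁ m) id)) ,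
    λ {m} → ∇-MaxD α α′ (proj₂ (proj₁ c)) m

  g-injective : Injective B._≈_ C._≈_ G
  g-injective {α , α′ , cα} {β , β′ , cβ} (p , q) =
    MaxD-reflects β α α′ β (proj₂ (proj₁ cα)) id
      (λ z → Congruence.reflexive β (proj₁ (proj₂ cα) z)) (λ m → p {m}) ,
    MaxD-reflects α β β′ α (proj₂ (proj₁ cβ)) id
      (λ z → Congruence.reflexive α (proj₁ (proj₂ cβ) z)) (λ m → q {m})

  g-isBooleanIsomorphism : Surjective B._≈_ C._≈_ G →
    IsBooleanIsomorphism (BCon V cm sd A A∈V) (Clop V cm sd A A∈V) G
  g-isBooleanIsomorphism surjective = record
    { isLatticeIsomorphism = record
      { isLatticeMonomorphism = record
        { isLatticeHomomorphism = record
          { isRelHomomorphism = record { cong = λ {x} {y} → g-cong x y }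
          ; ∧-homo = g-∧-homo
          ; ∨-homo = g-∨-homo
          }
        ; injective = λ {x} {y} → g-injective {x} {y}
        }
      ; surjective = surjective
      }
    ; ⊤-homo = _ , λ { {_ , φ-proper , _} _ → φ-proper }
    ; ⊥-homo = (λ { {φ , _} h → lift (h (Congruence.reflexive φ)) }) , λ ()
    ; ¬-homo = g-¬-homo
    }

  -- Lifting along `R` and surjectivity of `g`.

  CBLP⇒surjective : HasCBLP R → Surjective B._≈_ C._≈_ G
  CBLP⇒surjective cblp (W , o , c) =
    let (θ  , W⇒θ  , θ⇒W)   = open-D V cm sd A A∈V o
        (θ′ , ¬W⇒θ′ , θ′⇒¬W) = open-D V cm sd A A∈V c
        (α , cα , α⊆ , ⊆α) = cblp (image R θ) (image R θ′ , clopen⇒complemented θ θ′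
          (λ m ¬θ → ¬W⇒θ′ {m} (λ w → ¬θ (W⇒θ w)))
          (λ m θ′⊈ θ⊈ → θ′⇒¬W {m} θ′⊈ (θ⇒W θ⊈)))
    -- `α ∨ R` and `θ ∨ R` agree, so `α` and `θ` lie in the same maximal congruences.
    in (α , cα) , λ {z} z≈α →
      let (p , q) = g-cong z (α , cα) z≈α in
      (λ {m} h → θ⇒W {m} (image-MaxD α θ (λ w → α⊆ (base (inj₁ w))) {m} (p {m} h))) ,
      (λ {m} w → q {m} (image-MaxD θ α (λ w → ⊆α (base (inj₁ w))) {m} (W⇒θ {m} w)))

  surjective⇒CBLP : Surjective B._≈_ C._≈_ G → HasCBLP R
  surjective⇒CBLP surj β (β′ , j , m) =
    let ((α , α′ , c) , preimage) = surj (MaxD b , clopen-MaxD b b′ ∇⊆ (proj₁ m))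
        (α⇒β , β⇒α) = preimage {α , α′ , c} (id , id)
    in α , (α′ , c) ,
       ∨-least α R b
         -- `α` has a true complement, so no `R` enters this bound.
         (MaxD-reflects b α α′ b (proj₂ (proj₁ c)) id
           (λ z → Congruence.reflexive b (proj₁ (proj₂ c) z)) (λ m → α⇒β {m}))
         (Congruence.reflexive β) ,
       -- `b` and `b′` meet only below `R`, whence the bound `α ∨ R` instead of `α`.
       MaxD-reflects α b b′ (α ∨ R) ∇⊆ (λ z → base (inj₁ z)) (λ z → base (inj₂ (proj₁ m z)))
         (λ m → β⇒α {m})
    where
    b b′ : Congruence A
    b  = lift-congruence R β
    b′ = lift-congruence R β′
    ∇⊆ : ∇ ⊆ b ∨ b′
    ∇⊆ _ = ∨-quotient⊆∨ R β β′ (Congruence.reflexive β) (proj₂ j tt)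

theorem5p17 : ∀ {ℓ} (em : ExcludedMiddle (suc ℓ)) (zorn : Zorn (suc ℓ) ℓ ℓ (suc ℓ)) →
    let open Classical em in
    ∀ {𝑆 : Signature} (V : Variety 𝑆 ℓ) (cm : CongruenceModular V) (sd : Semidegenerate V) →
    StandingAssumption V cm sd →
    ∀ (A : Algebra 𝑆 ℓ) (A∈V : A ∈ᵥ V) →
    HasCBLP (Rad A) ⇔
    IsBooleanIsomorphism (BCon V cm sd A A∈V) (Clop V cm sd A A∈V) (g V cm sd A A∈V)
theorem5p17 em zorn V cm sd _ A A∈V =
  mk⇔ (λ cblp → g-isBooleanIsomorphism (CBLP⇒surjective cblp))
      (λ iso → surjective⇒CBLP
        (IsLatticeIsomorphism.surjective (IsBooleanIsomorphism.isLatticeIsomorphism iso)))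
  where open Lifting em zorn V cm sd A A∈V
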